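{- Let either $\Sigma=\mathcal F^\sharp_c$ and $S=\mathcal F$, or $\Sigma=\mathcal F^\sharp_c\cup\mathcal F^-$ and $S=\mathcal F^-$. Let $\overline\pi$ be an argument function from terms over $\Sigma$ to terms over $\Sigma^{ex}$, and let $(\succeq,\succ)$ be a reduction pair on terms over $\Sigma^{ex}$. Define relations $\geq,>$ on terms over $\Sigma$ by: $s\geq t$ iff $\overline\pi(s)\succeq\overline\pi(t)$, and $s>t$ iff $\overline\pi(s)\succ\overline\pi(t)$. Then $(\geq,>)$ is a reduction pair. If $\pi$ has the $S$-subterm property, and $(\succeq,\succ)$ respects $\rhd^!$, and $s\succeq\mathsf c_\sigma$ for all terms $s$ of type $\sigma$ (for all types $\sigma$), then $(\geq,>)$ respects $\rhd^S$.
   Context: **Types and terms.** Simple types are built from a set of base types with the right-associative constructor $\Rightarrow$. A type declaration is an expression $[\sigma_1\times\dots\times\sigma_n]\Rightarrow\tau$, $n\ge 0$. There are infinitely many variables of each type; function symbols each carry a type declaration. Terms over a set of function symbols are: variables $x:\sigma$; applications $s\cdot t:\tau$ for $s:\sigma\Rightarrow\tau$, $t:\sigma$ (left-associative); abstractions $\lambda x.s:\sigma\Rightarrow\tau$ for $x:\sigma$, $s:\tau$; functional terms $f(s_1,\dots,s_n):\tau$ for $f:[\sigma_1\times\dots\times\sigma_n]\Rightarrow\tau$, $s_i:\sigma_i$ ($\tau$ may be functional). Terms are modulo $\alpha$-conversion; $FV(s)$ is the set of free variables; substitutions are type-preserving, with finite domain, and capture-avoiding. A context $C[]$ is a term with one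 hole; filling it may capture variables. **Signature.** $\mathcal F$ is the set of function symbols of a given rewrite system, and $\mathcal D\subseteq\mathcal F$ its set of defined symbols (those $f$ for which some rule has a left-hand side of the form $f(l_1,\dots,l_n)\cdot l_{n+1}\cdots l_m$). $\mathcal F^\sharp_c$ extends $\mathcal F$ with a marked symbol $f^\sharp$ (same declaration as $f$) for each $f\in\mathcal D$ and a constant $\mathsf c_\sigma:\sigma$ for each type $\sigma$. $\mathcal F^-=\{f^-\mid f\in\mathcal F\}$ is a set of fresh copies with the same declarations. **Argument functions.** Let $\Sigma^{ex}$ be a set of function symbols and $\pi$ a type-respecting function mapping each term $f(x_1,\dots,x_n)$ with $f\in\Sigma$ to some term over $\Sigma^{ex}$ with $FV(\pi(f(\vec x)))\subseteq\{\vec x\}$. The argument function $\overline\pi$ is the extension to all terms over $\Sigma$: $\overline\pi(s\cdot t)=\overline\pi(s)\cdot\overline\pi(t)$; $\overline\pi(\lambda x.s)=\lambda x.\overline\pi(s)$; $\overline\pi(x)=x$ for variables; $\overline\pi(f(s_1,\dots,s_n))=\pi(f(x_1,\dots,x_n))[x_1:=\overline\pi(s_1),\dots,x_n:=\overline\pi(s_n)]$. $\pi$ has the $S$-subterm property if $FV(\pi(f(\vec x)))=\{\vec x\}$ for all $f\in S$. **Reduction pairs.** A reduction pair (on terms over a given signature) is a quasi-ordering $\succeq$ and a well-founded ordering $\succ$ such that: $\succ\cdot\succeq\,\subseteq\,\succ$ or $\succeq\cdot\succ\,\subseteq\,\succ$; both are closed under substitution; $\succeq$ is monotonic (if $s\succeq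 t$ and $s,t$ have the same type then $C[s]\succeq C[t]$ for all contexts); and always $(\lambda x.s)\cdot t\succeq s[x:=t]$. **The relations $\rhd^S$ and $\rhd^!$.** $\rhd^S$ is the relation on base-type terms (with reflexive closure $\unrhd^S$) generated by: $(\lambda x.s)\cdot t_0\cdots t_n\rhd^S u$ if $s[x:=t_0]\cdot t_1\cdots t_n\unrhd^S u$; $f(s_1,\dots,s_m)\cdot t_1\cdots t_n\unrhd^S u$ if $f\in S$ and $s_i\cdot\vec{\mathsf c}\unrhd^S u$ for some $i$; $s\cdot t_1\cdots t_n\unrhd^S u$ if $t_i\cdot\vec{\mathsf c}\unrhd^S u$ for some $i$ ($s$ of any form). Here $s\cdot\vec{\mathsf c}$ is $s$ applied to constants $\mathsf c_\sigma$ of the right types so as to obtain base type. $\rhd^!$ is defined in the same way but with the second clause for all function symbols $f$. A pair of relations $(\succeq,\succ)$ respects such a relation if the latter is contained in $(\succeq\cup\succ)^*$.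
   Formalization: The second part is false as stated: it is proved assuming also c_σ ⪰ π̄(c_σ); then s ▷^S t gives π̄(s) (⪰∪≻)* π̄(t), and the literal "(≥,>) respects ▷^S" is proved only when ⪰∪≻ is transitive. Equality of base types is assumed decidable. -}

module Defs where

open import Data.Empty using (⊥)
open import Data.List.Base using (List; []; _∷_)
open import Data.List.Membership.Propositional using (_∈_; _∉_)
open import Data.List.Relation.Unary.All using (All; []; _∷_; lookup)
open import Data.Nat.Base using (ℕ)
open import Data.Nat.Properties as ℕ using ()
open import Data.Product.Base using (∃; ∃-syntax; _×_; _,_)
open import Data.Sum.Base using (_⊎_; inj₁; inj₂)
open import Data.Unit.Base using (⊤)
open import Function.Base using (flip)
open import Induction.WellFounded using (WellFounded)
open import Level using (0ℓ)
open import Relation.Binary.Construct.Closure.Reflexive using (ReflClosure)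
open import Relation.Binary.Construct.Closure.ReflexiveTransitive using (Star)
open import Relation.Binary.Construct.Union using () renaming (_∪_ to _∪ʳ_)
open import Relation.Binary.Core using (Rel)
open import Relation.Binary.Definitions using (DecidableEquality; Trans)
open import Relation.Binary.PropositionalEquality.Core using (_≡_; refl)
open import Relation.Binary.Structures using (IsPreorder; IsStrictPartialOrder)
open import Relation.Nullary.Decidable.Core using (yes; no)

-- Equality of base types has to be decidable so that a named variable can be
-- bound by an abstraction (see `bind`).
module AFS (Base : Set) (_≟ᵇ_ : DecidableEquality Base) where

  infixr 6 _⇒_

  data Type : Set where
    base : Base → Type
    _⇒_  : Type → Type → Type

  _≟ᵗ_ : DecidableEquality Type
  base a  ≟ᵗ base b with a ≟ᵇ b
  ... | yes refl = yes refl
  ... | no a≢b   = no λ { refl → a≢b refl }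
  base _  ≟ᵗ (_ ⇒ _) = no λ ()
  (_ ⇒ _) ≟ᵗ base _  = no λ ()
  (σ ⇒ τ) ≟ᵗ (σ′ ⇒ τ′) with σ ≟ᵗ σ′ | τ ≟ᵗ τ′
  ... | yes refl | yes refl = yes refl
  ... | no σ≢σ′  | _        = no λ { refl → σ≢σ′ refl }
  ... | yes _    | no τ≢τ′  = no λ { refl → τ≢τ′ refl }

  -- `Σ σs τ` is the set of the symbols of Σ with declaration [σ₁ × … × σₙ] ⇒ τ.
  Signature : Set₁
  Signature = List Type → Type → Set

  SymbolSet : Signature → Set₁
  SymbolSet Σ = ∀ {σs τ} → Σ σs τ → Set

  infixr 5 _∪_

  _∪_ : Signature → Signature → Signature
  (Σ ∪ Σ′) σs τ = Σ σs τ ⊎ Σ′ σs τ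

  Scope : Set₁
  Scope = Type → Set

  data Name (σ : Type) : Set where
    name : ℕ → Name σ

  infixl 5 _▸_

  data _▸_ (V : Scope) (σ : Type) : Scope where
    new : (V ▸ σ) σ
    old : ∀ {τ} → V τ → (V ▸ σ) τ

  infixl 7 _·_ _·*_

  -- `Term Σ V τ`: terms of type τ over Σ whose free variables are in V.  Bound
  -- variables are nameless, so α-equivalent terms are equal.
  data Term (Σ : Signature) (V : Scope) : Type → Set where
    var : ∀ {τ} → V τ → Term Σ V τ
    _·_ : ∀ {σ τ} → Term Σ V (σ ⇒ τ) → Term Σ V σ → Term Σ V τ
    lam : ∀ {σ τ} → Term Σ (V ▸ σ) τ → Term Σ V (σ ⇒ τ)
    fun : ∀ {σs τ} → Σ σs τ → All (Term Σ V) σs → Term Σ V τ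

  -- The terms proper have named free variables; other scopes only serve for
  -- the bodies of abstractions and for argument functions.
  Tm : Signature → Type → Set
  Tm Σ = Term Σ Name

  SomeTm : Signature → Set
  SomeTm Σ = ∃ (Tm Σ)

  data Free {Σ : Signature} {V : Scope} {σ : Type} (v : V σ) :
            ∀ {τ} → Term Σ V τ → Set where
    var  : Free v (var v)
    appˡ : ∀ {ρ τ} {s : Term Σ V (ρ ⇒ τ)} {t} → Free v s → Free v (s · t)
    appʳ : ∀ {ρ τ} {s : Term Σ V (ρ ⇒ τ)} {t} → Free v t → Free v (s · t)
    lam  : ∀ {ρ τ} {s : Term Σ (V ▸ ρ) τ} → Free (old v) s → Free v (lam s)
    fun  : ∀ {ρ σs τ} {f : Σ σs τ} {ss : All (Term Σ V) σs} (i : ρ ∈ σs) →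
           Free v (lookup ss i) → Free v (fun f ss)

  extᵣ : ∀ {V W : Scope} {σ} → (∀ {τ} → V τ → W τ) →
         ∀ {τ} → (V ▸ σ) τ → (W ▸ σ) τ
  extᵣ ρ new     = new
  extᵣ ρ (old v) = old (ρ v)

  module _ {Σ : Signature} where

    mutual
      ren : ∀ {V W : Scope} → (∀ {τ} → V τ → W τ) →
            ∀ {τ} → Term Σ V τ → Term Σ W τ
      ren ρ (var v)    = var (ρ v)
      ren ρ (s · t)    = ren ρ s · ren ρ t
      ren ρ (lam s)    = lam (ren (extᵣ ρ) s)
      ren ρ (fun f ss) = fun f (rens ρ ss)

      rens : ∀ {V W : Scope} → (∀ {τ} → V τ → W τ) →
             ∀ {σs} → All (Term Σ V) σs → All (Term Σ W) σs
      rens ρ []       = []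
      rens ρ (s ∷ ss) = ren ρ s ∷ rens ρ ss

    extₛ : ∀ {V W : Scope} {σ} → (∀ {τ} → V τ → Term Σ W τ) →
           ∀ {τ} → (V ▸ σ) τ → Term Σ (W ▸ σ) τ
    extₛ γ new     = var new
    extₛ γ (old v) = ren old (γ v)

    mutual
      sub : ∀ {V W : Scope} → (∀ {τ} → V τ → Term Σ W τ) →
            ∀ {τ} → Term Σ V τ → Term Σ W τ
      sub γ (var v)    = γ v
      sub γ (s · t)    = sub γ s · sub γ t
      sub γ (lam s)    = lam (sub (extₛ γ) s)
      sub γ (fun f ss) = fun f (subs γ ss)

      subs : ∀ {V W : Scope} → (∀ {τ} → V τ → Term Σ W τ) →
             ∀ {σs} → All (Term Σ V) σs → All (Term Σ W) σs
      subs γ []       = []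
      subs γ (s ∷ ss) = sub γ s ∷ subs γ ss

    instantiate : ∀ {V : Scope} {σ} → Term Σ V σ →
                  ∀ {τ} → (V ▸ σ) τ → Term Σ V τ
    instantiate t new     = t
    instantiate t (old v) = var v

    -- For `lam s` standing for λx.s, this is s[x := t].
    _[_] : ∀ {V : Scope} {σ τ} → Term Σ (V ▸ σ) τ → Term Σ V σ → Term Σ V τ
    s [ t ] = sub (instantiate t) s

  record Substitution (Σ : Signature) : Set where
    field
      apply  : ∀ {σ} → Name σ → Tm Σ σ
      domain : List (∃ Name)
      finite : ∀ {σ} (x : Name σ) → (σ , x) ∉ domain → apply x ≡ var x

  _⟨_⟩ : ∀ {Σ} → SomeTm Σ → Substitution Σ → SomeTm Σ
  (σ , s) ⟨ γ ⟩ = σ , sub (Substitution.apply γ) s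

  bind : ∀ {σ} → Name σ → ∀ {τ} → Name τ → (Name ▸ σ) τ
  bind {σ} (name m) {τ} (name n) with σ ≟ᵗ τ | m ℕ.≟ n
  ... | yes refl | yes _ = new
  ... | _        | _     = old (name n)

  -- λx.s for a named variable x, which is thereby captured in s.
  ƛ : ∀ {Σ σ τ} → Name σ → Tm Σ τ → Tm Σ (σ ⇒ τ)
  ƛ x s = lam (ren (bind x) s)

  -- `Context Σ σ τ`: contexts of type τ with a hole of type σ.  Their binders
  -- are named, since filling the hole may capture variables.
  mutual
    data Context (Σ : Signature) (σ : Type) : Type → Set where
      □    : Context Σ σ σ
      appˡ : ∀ {ρ τ} → Context Σ σ (ρ ⇒ τ) → Tm Σ ρ → Context Σ σ τ
      appʳ : ∀ {ρ τ} → Tm Σ (ρ ⇒ τ) → Context Σ σ ρ → Context Σ σ τ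
      lam  : ∀ {ρ τ} → Name ρ → Context Σ σ τ → Context Σ σ (ρ ⇒ τ)
      fun  : ∀ {σs τ} → Σ σs τ → ArgContext Σ σ σs → Context Σ σ τ

    data ArgContext (Σ : Signature) (σ : Type) : List Type → Set where
      here  : ∀ {ρ σs} → Context Σ σ ρ → All (Tm Σ) σs → ArgContext Σ σ (ρ ∷ σs)
      there : ∀ {ρ σs} → Tm Σ ρ → ArgContext Σ σ σs → ArgContext Σ σ (ρ ∷ σs)

  mutual
    fill : ∀ {Σ σ τ} → Context Σ σ τ → Tm Σ σ → Tm Σ τ
    fill □          s = s
    fill (appˡ C t) s = fill C s · t
    fill (appʳ t C) s = t · fill C s
    fill (lam x C)  s = ƛ x (fill C s)
    fill (fun f Cs) s = fun f (fillArgs Cs s)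

    fillArgs : ∀ {Σ σ σs} → ArgContext Σ σ σs → Tm Σ σ → All (Tm Σ) σs
    fillArgs (here C ts)  s = fill C s ∷ ts
    fillArgs (there t Cs) s = t ∷ fillArgs Cs s

  -- Both relations may relate terms of different types.
  record IsReductionPair (Σ : Signature) (_≽_ _≻_ : Rel (SomeTm Σ) 0ℓ) : Set where
    field
      ≽-isPreorder           : IsPreorder _≡_ _≽_
      ≻-isStrictPartialOrder : IsStrictPartialOrder _≡_ _≻_
      ≻-wellFounded          : WellFounded (flip _≻_)
      compatible             : Trans _≻_ _≽_ _≻_ ⊎ Trans _≽_ _≻_ _≻_
      ≽-substitution         : ∀ (γ : Substitution Σ) {s t} →
                               s ≽ t → (s ⟨ γ ⟩) ≽ (t ⟨ γ ⟩)
      ≻-substitution         : ∀ (γ : Substitution Σ) {s t} →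
                               s ≻ t → (s ⟨ γ ⟩) ≻ (t ⟨ γ ⟩)
      ≽-monotonic            : ∀ {σ τ} (C : Context Σ σ τ) {s t : Tm Σ σ} →
                               (σ , s) ≽ (σ , t) → (τ , fill C s) ≽ (τ , fill C t)
      ≽-beta                 : ∀ {σ τ} (s : Term Σ (Name ▸ σ) τ) (t : Tm Σ σ) →
                               (τ , lam s · t) ≽ (τ , s [ t ])

  infixr 5 _∷_

  -- `Spine Σ σ τ`: lists t₁, …, tₙ of terms such that s · t₁ ⋯ tₙ has type τ
  -- whenever s has type σ.
  data Spine (Σ : Signature) : Type → Type → Set where
    []  : ∀ {τ} → Spine Σ τ τ
    _∷_ : ∀ {σ ρ τ} → Tm Σ σ → Spine Σ ρ τ → Spine Σ (σ ⇒ ρ) τ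

  _·*_ : ∀ {Σ σ τ} → Tm Σ σ → Spine Σ σ τ → Tm Σ τ
  s ·* []       = s
  s ·* (t ∷ ts) = (s · t) ·* ts

  Constants : Signature → Set
  Constants Σ = ∀ σ → Σ [] σ

  target : Type → Base
  target (base b) = b
  target (_ ⇒ τ)  = target τ

  module _ {Σ : Signature} (c : Constants Σ) where

    const : ∀ σ → Tm Σ σ
    const σ = fun (c σ) []

    consts : ∀ σ → Spine Σ σ (base (target σ))
    consts (base _) = []
    consts (σ ⇒ τ)  = const σ ∷ consts τ

    saturate : ∀ {σ} → Tm Σ σ → SomeTm Σ
    saturate {σ} s = base (target σ) , s ·* consts σ

    -- In `argument`, s may itself be an application, so t is an arbitrary
    -- argument of the term on the left.
    data Subterm (S : SymbolSet Σ) : Rel (SomeTm Σ) 0ℓ where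
      beta     : ∀ {σ τ b u} (s : Term Σ (Name ▸ σ) τ) (t : Tm Σ σ)
                 (ts : Spine Σ τ (base b)) →
                 ReflClosure (Subterm S) (base b , (s [ t ]) ·* ts) u →
                 Subterm S (base b , (lam s · t) ·* ts) u
      symbol   : ∀ {σs ρ σ b u} (f : Σ σs ρ) → S f → (ss : All (Tm Σ) σs)
                 (ts : Spine Σ ρ (base b)) (i : σ ∈ σs) →
                 ReflClosure (Subterm S) (saturate (lookup ss i)) u →
                 Subterm S (base b , fun f ss ·* ts) u
      argument : ∀ {σ τ b u} (s : Tm Σ (σ ⇒ τ)) (t : Tm Σ σ)
                 (ts : Spine Σ τ (base b)) →
                 ReflClosure (Subterm S) (saturate t) u →
                 Subterm S (base b , (s · t) ·* ts) u

    Subterm! : Rel (SomeTm Σ) 0ℓ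
    Subterm! = Subterm (λ _ → ⊤)

  Respects : ∀ {Σ} → (_≽_ _≻_ _▷_ : Rel (SomeTm Σ) 0ℓ) → Set
  Respects _≽_ _≻_ _▷_ = ∀ {s t} → s ▷ t → Star (_≽_ ∪ʳ _≻_) s t

  -- The value at f is π(f(x₁, …, xₙ)), with the positions in σs as x₁, …, xₙ.
  ArgFun : Signature → Signature → Set
  ArgFun Σ Σᵉˣ = ∀ {σs τ} → Σ σs τ → Term Σᵉˣ (_∈ σs) τ

  module _ {Σ Σᵉˣ : Signature} (π : ArgFun Σ Σᵉˣ) where

    mutual
      extend : ∀ {V : Scope} {τ} → Term Σ V τ → Term Σᵉˣ V τ
      extend (var v)    = var v
      extend (s · t)    = extend s · extend t
      extend (lam s)    = lam (extend s)
      extend (fun f ss) = sub (lookup (extends ss)) (π f)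

      extends : ∀ {V : Scope} {σs} → All (Term Σ V) σs → All (Term Σᵉˣ V) σs
      extends []       = []
      extends (s ∷ ss) = extend s ∷ extends ss

    extend′ : SomeTm Σ → SomeTm Σᵉˣ
    extend′ (σ , s) = σ , extend s

    -- The inclusion FV(π(f(x₁, …, xₙ))) ⊆ {x₁, …, xₙ} holds by typing.
    SubtermProperty : SymbolSet Σ → Set
    SubtermProperty S = ∀ {σs τ} (f : Σ σs τ) → S f →
                        ∀ {σ} (i : σ ∈ σs) → Free i (π f)

  record RewriteSystem : Set₁ where
    field
      𝓕    : Signature
      Rule : ∀ {σ} → Rel (Tm 𝓕 σ) 0ℓ

    Defined : SymbolSet 𝓕
    Defined {σs} {τ} f = ∃[ ls ] ∃[ σ ] ∃[ ts ] ∃[ r ]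
                         Rule {σ} (fun f ls ·* ts) r

    -- Irrelevance of the last argument of `mark` makes f♯ unique.
    data 𝓕♯c : Signature where
      sym  : ∀ {σs τ} → 𝓕 σs τ → 𝓕♯c σs τ
      mark : ∀ {σs τ} (f : 𝓕 σs τ) → .(Defined f) → 𝓕♯c σs τ
      cst  : ∀ σ → 𝓕♯c [] σ

    data 𝓕⁻ : Signature where
      _⁻ : ∀ {σs τ} → 𝓕 σs τ → 𝓕⁻ σs τ

    from𝓕 : SymbolSet 𝓕♯c
    from𝓕 (sym _)    = ⊤
    from𝓕 (mark _ _) = ⊥
    from𝓕 (cst _)    = ⊥

    from𝓕⁻ : SymbolSet (𝓕♯c ∪ 𝓕⁻)
    from𝓕⁻ (inj₁ _) = ⊥
    from𝓕⁻ (inj₂ _) = ⊤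

  -- The two choices of (Σ , S), with the constants c_σ that occur in Σ.
  data Setting (R : RewriteSystem) :
               (Σ : Signature) → Constants Σ → SymbolSet Σ → Set₁ where
    plain  : let open RewriteSystem R in Setting R 𝓕♯c cst from𝓕
    copied : let open RewriteSystem R in
             Setting R (𝓕♯c ∪ 𝓕⁻) (λ σ → inj₁ (cst σ)) from𝓕⁻

{-# OPTIONS --safe #-}

-- Monotonicity of ≥ comes down to the fact that substituting ≽-related terms
-- into a fixed term p gives ≽-related terms.  It is proved by induction on p,
-- with λ-abstractions opened by fresh names, so that binders do not force
-- the induction out of the terms with named variables.  For the second part,
-- if x is free in p and p[γ] is applied to arguments ts making it of base type,
-- then ▷! and ≽ lead from p[γ] ts to γ(x) applied to constants: ▷! descends to
-- x, and a β-step crosses each λ because the spine supplies its argument.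

module Submission where

open import Defs
open import Data.List.Membership.Propositional using (_∈_)
open import Data.List.Relation.Unary.All using (All; []; _∷_; lookup)
open import Data.List.Relation.Unary.Any using (here; there)
open import Data.Nat.Base using (ℕ; zero; suc; _<_; _⊔_)
open import Data.Nat.Properties
  using (n<1+n; <-irrefl; m<n⇒m<n⊔o; m<n⇒m<o⊔n)
  renaming (_≟_ to _≟ⁿ_)
open import Data.Product.Base using (∃-syntax; _×_; _,_)
open import Data.Sum.Base using (_⊎_; inj₁; inj₂)
open import Data.Unit.Base using (tt)
open import Function.Base using (_on_; _∘_; id)
open import Level using (0ℓ)
open import Relation.Binary.Core using (Rel)
open import Relation.Binary.Construct.Closure.Reflexive
  using (ReflClosure; refl)
  renaming ([_] to step)
open import Relation.Binary.Construct.Closure.ReflexiveTransitive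
  using (Star; ε; _◅_; _◅◅_; fold)
open import Relation.Binary.Construct.Union using (_∪_)
open import Relation.Binary.Construct.On as On using ()
open import Relation.Binary.Definitions using (DecidableEquality; Trans; Transitive)
open import Relation.Binary.PropositionalEquality
  using (_≡_; _≢_; refl; sym; trans; cong; cong₂; subst; subst₂; isEquivalence;
         ≡-≟-identity)
open import Relation.Binary.Structures using (IsPreorder; IsStrictPartialOrder)
open import Relation.Nullary.Decidable.Core using (yes; no)
open import Relation.Nullary.Negation using (contradiction)

module _ {Base : Set} {_≟ᵇ_ : DecidableEquality Base} where
  open AFS Base _≟ᵇ_ hiding (_∪_)

  -- Composition laws of renaming and substitution.

  module _ {Σ : Signature} where

    -- The composition laws assume their compositions only pointwise, which
    -- takes the place of function extensionality under binders.

    mutual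
      ren-ren : ∀ {U V W : Scope} {ρ : ∀ {τ} → U τ → V τ}
                {ρ′ : ∀ {τ} → V τ → W τ} {θ : ∀ {τ} → U τ → W τ} →
                (∀ {τ} (v : U τ) → ρ′ (ρ v) ≡ θ v) →
                ∀ {τ} (s : Term Σ U τ) → ren ρ′ (ren ρ s) ≡ ren θ s
      ren-ren eq (var v)    = cong var (eq v)
      ren-ren eq (s · t)    = cong₂ _·_ (ren-ren eq s) (ren-ren eq t)
      ren-ren eq (lam s)    =
        cong lam (ren-ren (λ { new → refl ; (old v) → cong old (eq v) }) s)
      ren-ren eq (fun f ss) = cong (fun f) (rens-rens eq ss)

      rens-rens : ∀ {U V W : Scope} {ρ : ∀ {τ} → U τ → V τ}
                  {ρ′ : ∀ {τ} → V τ → W τ} {θ : ∀ {τ} → U τ → W τ} →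
                  (∀ {τ} (v : U τ) → ρ′ (ρ v) ≡ θ v) →
                  ∀ {σs} (ss : All (Term Σ U) σs) → rens ρ′ (rens ρ ss) ≡ rens θ ss
      rens-rens eq []       = refl
      rens-rens eq (s ∷ ss) = cong₂ _∷_ (ren-ren eq s) (rens-rens eq ss)

    mutual
      sub-ren : ∀ {U V W : Scope} {ρ : ∀ {τ} → U τ → V τ}
                {γ : ∀ {τ} → V τ → Term Σ W τ} {δ : ∀ {τ} → U τ → Term Σ W τ} →
                (∀ {τ} (v : U τ) → γ (ρ v) ≡ δ v) →
                ∀ {τ} (s : Term Σ U τ) → sub γ (ren ρ s) ≡ sub δ s
      sub-ren eq (var v)    = eq v
      sub-ren eq (s · t)    = cong₂ _·_ (sub-ren eq s) (sub-ren eq t)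
      sub-ren eq (lam s)    =
        cong lam (sub-ren (λ { new → refl ; (old v) → cong (ren old) (eq v) }) s)
      sub-ren eq (fun f ss) = cong (fun f) (subs-rens eq ss)

      subs-rens : ∀ {U V W : Scope} {ρ : ∀ {τ} → U τ → V τ}
                  {γ : ∀ {τ} → V τ → Term Σ W τ} {δ : ∀ {τ} → U τ → Term Σ W τ} →
                  (∀ {τ} (v : U τ) → γ (ρ v) ≡ δ v) →
                  ∀ {σs} (ss : All (Term Σ U) σs) → subs γ (rens ρ ss) ≡ subs δ ss
      subs-rens eq []       = refl
      subs-rens eq (s ∷ ss) = cong₂ _∷_ (sub-ren eq s) (subs-rens eq ss)

    -- Both sides fuse to one renaming, `old` after `ρ`. The binder case of `ren-sub` needs this at
    -- the variables bound further out.
    ren-old : ∀ {V W : Scope} {σ} (ρ : ∀ {τ} → V τ → W τ) {τ} (s : Term Σ V τ) →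
              ren {V = V ▸ σ} {W ▸ σ} (extᵣ ρ) (ren old s) ≡ ren old (ren ρ s)
    ren-old ρ s = trans (ren-ren {θ = λ v → old (ρ v)} (λ _ → refl) s)
                        (sym (ren-ren (λ _ → refl) s))

    mutual
      ren-sub : ∀ {U V W : Scope} {γ : ∀ {τ} → U τ → Term Σ V τ}
                {ρ : ∀ {τ} → V τ → W τ} {δ : ∀ {τ} → U τ → Term Σ W τ} →
                (∀ {τ} (v : U τ) → ren ρ (γ v) ≡ δ v) →
                ∀ {τ} (s : Term Σ U τ) → ren ρ (sub γ s) ≡ sub δ s
      ren-sub eq (var v)    = eq v
      ren-sub eq (s · t)    = cong₂ _·_ (ren-sub eq s) (ren-sub eq t)
      ren-sub {γ = γ} {ρ} eq (lam s) = cong lam (ren-sub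
        (λ { new     → refl
           ; (old v) → trans (ren-old ρ (γ v)) (cong (ren old) (eq v)) }) s)
      ren-sub eq (fun f ss) = cong (fun f) (rens-subs eq ss)

      rens-subs : ∀ {U V W : Scope} {γ : ∀ {τ} → U τ → Term Σ V τ}
                  {ρ : ∀ {τ} → V τ → W τ} {δ : ∀ {τ} → U τ → Term Σ W τ} →
                  (∀ {τ} (v : U τ) → ren ρ (γ v) ≡ δ v) →
                  ∀ {σs} (ss : All (Term Σ U) σs) → rens ρ (subs γ ss) ≡ subs δ ss
      rens-subs eq []       = refl
      rens-subs eq (s ∷ ss) = cong₂ _∷_ (ren-sub eq s) (rens-subs eq ss)

    sub-old : ∀ {V W : Scope} {σ} (γ : ∀ {τ} → V τ → Term Σ W τ)
              {τ} (s : Term Σ V τ) →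
              sub {V = V ▸ σ} {W ▸ σ} (extₛ γ) (ren old s) ≡ ren old (sub γ s)
    sub-old γ s = trans (sub-ren {δ = λ v → ren old (γ v)} (λ _ → refl) s)
                        (sym (ren-sub (λ _ → refl) s))

    mutual
      sub-sub : ∀ {U V W : Scope} {γ : ∀ {τ} → U τ → Term Σ V τ}
                {θ : ∀ {τ} → V τ → Term Σ W τ} {δ : ∀ {τ} → U τ → Term Σ W τ} →
                (∀ {τ} (v : U τ) → sub θ (γ v) ≡ δ v) →
                ∀ {τ} (s : Term Σ U τ) → sub θ (sub γ s) ≡ sub δ s
      sub-sub eq (var v)    = eq v
      sub-sub eq (s · t)    = cong₂ _·_ (sub-sub eq s) (sub-sub eq t)
      sub-sub {γ = γ} {θ} eq (lam s) = cong lam (sub-sub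
        (λ { new     → refl
           ; (old v) → trans (sub-old θ (γ v)) (cong (ren old) (eq v)) }) s)
      sub-sub eq (fun f ss) = cong (fun f) (subs-subs eq ss)

      subs-subs : ∀ {U V W : Scope} {γ : ∀ {τ} → U τ → Term Σ V τ}
                  {θ : ∀ {τ} → V τ → Term Σ W τ} {δ : ∀ {τ} → U τ → Term Σ W τ} →
                  (∀ {τ} (v : U τ) → sub θ (γ v) ≡ δ v) →
                  ∀ {σs} (ss : All (Term Σ U) σs) → subs θ (subs γ ss) ≡ subs δ ss
      subs-subs eq []       = refl
      subs-subs eq (s ∷ ss) = cong₂ _∷_ (sub-sub eq s) (subs-subs eq ss)

    mutual
      -- Agreement with `var` is asked only at free variables: in `ƛ-fresh` the substitution at hand
      -- fixes the names that occur, but not the name being bound.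
      sub-id : ∀ {V : Scope} {γ : ∀ {τ} → V τ → Term Σ V τ} {τ} (s : Term Σ V τ) →
               (∀ {ρ} (v : V ρ) → Free v s → γ v ≡ var v) → sub γ s ≡ s
      sub-id (var v)    eq = eq v var
      sub-id (s · t)    eq =
        cong₂ _·_ (sub-id s (λ v → eq v ∘ appˡ)) (sub-id t (λ v → eq v ∘ appʳ))
      sub-id (lam s)    eq = cong lam (sub-id s
        (λ { new _ → refl ; (old v) free → cong (ren old) (eq v (lam free)) }))
      sub-id (fun f ss) eq = cong (fun f) (subs-id ss (λ v i → eq v ∘ fun i))

      subs-id : ∀ {V : Scope} {γ : ∀ {τ} → V τ → Term Σ V τ} {σs}
                (ss : All (Term Σ V) σs) →
                (∀ {ρ} (v : V ρ) {σ} (i : σ ∈ σs) → Free v (lookup ss i) →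
                 γ v ≡ var v) →
                subs γ ss ≡ ss
      subs-id []       eq = refl
      subs-id (s ∷ ss) eq =
        cong₂ _∷_ (sub-id s (λ v → eq v (here refl)))
                  (subs-id ss (λ v i → eq v (there i)))

    lookup-subs : ∀ {V W : Scope} (γ : ∀ {τ} → V τ → Term Σ W τ) {σs}
                  (ss : All (Term Σ V) σs) {σ} (i : σ ∈ σs) →
                  lookup (subs γ ss) i ≡ sub γ (lookup ss i)
    lookup-subs γ (s ∷ ss) (here refl) = refl
    lookup-subs γ (s ∷ ss) (there i)   = lookup-subs γ ss i

    infixl 5 _▹_

    _▹_ : ∀ {V W : Scope} {σ} → (∀ {τ} → V τ → Term Σ W τ) → Term Σ W σ →
          ∀ {τ} → (V ▸ σ) τ → Term Σ W τ
    (γ ▹ t) new     = t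
    (γ ▹ t) (old v) = γ v

    -- Instantiation undoes the weakening in `extₛ`, so passing a binder and filling it is one
    -- substitution from a larger scope into the same `W`. Inductions on a term thereby keep their
    -- target scope.
    sub-extₛ-[] : ∀ {V W : Scope} {σ τ} (γ : ∀ {τ} → V τ → Term Σ W τ)
                  (s : Term Σ (V ▸ σ) τ) (t : Term Σ W σ) →
                  sub (extₛ γ) s [ t ] ≡ sub (γ ▹ t) s
    sub-extₛ-[] γ s t = sub-sub
      (λ { new     → refl
         ; (old v) → trans (sub-ren (λ _ → refl) (γ v)) (sub-id (γ v) (λ _ _ → refl)) })
      s

    -- Fresh names and the opening of abstractions.

    mutual
      -- An arbitrary `index` takes the place of `label`, so that the induction can enter the scopes
      -- of abstractions.
      free-bounded : ∀ {V : Scope} (index : ∀ {ρ} → V ρ → ℕ) {τ} (s : Term Σ V τ) →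
                     ∃[ n ] (∀ {ρ} (v : V ρ) → Free v s → index v < n)
      free-bounded index (var v) = suc (index v) , λ { _ var → n<1+n _ }
      free-bounded index (s · t) with free-bounded index s | free-bounded index t
      ... | m , <m | n , <n = m ⊔ n , λ
        { v (appˡ free) → m<n⇒m<n⊔o n (<m v free)
        ; v (appʳ free) → m<n⇒m<o⊔n m (<n v free) }
      free-bounded index (lam s)
        -- The bound variable gets the default index zero, which is harmless: only `old` variables
        -- of the body are free in the abstraction.
        with free-bounded (λ { new → zero ; (old v) → index v }) s
      ... | n , <n = n , λ { v (lam free) → <n (old v) free }
      free-bounded index (fun f ss) with frees-bounded index ss
      ... | n , <n = n , λ { v (fun i free) → <n v i free }

      frees-bounded : ∀ {V : Scope} (index : ∀ {ρ} → V ρ → ℕ) {σs}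
                      (ss : All (Term Σ V) σs) →
                      ∃[ n ] (∀ {ρ} (v : V ρ) {σ} (i : σ ∈ σs) →
                              Free v (lookup ss i) → index v < n)
      frees-bounded index [] = zero , λ _ ()
      frees-bounded index (s ∷ ss)
        with free-bounded index s | frees-bounded index ss
      ... | m , <m | n , <n = m ⊔ n , λ
        { v (here refl) free → m<n⇒m<n⊔o n (<m v free)
        ; v (there i)   free → m<n⇒m<o⊔n m (<n v i free) }

    label : ∀ {σ} → Name σ → ℕ
    label (name n) = n

    -- The number is avoided at all types at once, which is stronger than distinctness of names and
    -- leaves the type of the fresh name open.
    fresh : ∀ {τ τ′} (s : Tm Σ τ) (t : Tm Σ τ′) →
            ∃[ n ] (∀ {ρ} (y : Name ρ) → Free y s → label y ≢ n) ×
                   (∀ {ρ} (y : Name ρ) → Free y t → label y ≢ n)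
    fresh s t with free-bounded label s | free-bounded label t
    ... | m , <m | n , <n =
      m ⊔ n , (λ y free y≡ → <-irrefl y≡ (m<n⇒m<n⊔o n (<m y free)))
            , (λ y free y≡ → <-irrefl y≡ (m<n⇒m<o⊔n m (<n y free)))

    bind-self : ∀ {σ} (x : Name σ) → bind x x ≡ new
    bind-self {σ} (name n)
      -- `bind` reduces only once its two equality decisions are known to be `yes refl`.
      rewrite ≡-≟-identity _≟ᵗ_ (refl {x = σ}) | ≡-≟-identity _≟ⁿ_ (refl {x = n})
      = refl

    bind-other : ∀ {σ τ} (x : Name σ) (y : Name τ) → label y ≢ label x →
                 bind x y ≡ old y
    bind-other {σ} {τ} (name m) (name n) n≢m with σ ≟ᵗ τ | m ≟ⁿ n
    ... | yes refl | yes m≡n = contradiction (sym m≡n) n≢m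
    ... | yes refl | no _    = refl
    ... | no _     | _       = refl

    -- By freshness, `bind x` captures exactly the occurrences that come from the bound variable. A
    -- nameless abstraction thus takes the form of a context with a named binder, as `≽-monotonic`
    -- requires.
    ƛ-fresh : ∀ {σ τ} (x : Name σ) (s : Term Σ (Name ▸ σ) τ) →
              (∀ {ρ} (y : Name ρ) → Free y (lam s) → label y ≢ label x) →
              ƛ x (s [ var x ]) ≡ lam s
    ƛ-fresh {σ} x s x∉s = cong lam (trans (ren-sub (λ _ → refl) s) (sub-id s
      (λ { new _        → cong var (bind-self x)
         ; (old y) free → cong var (bind-other x y (x∉s y (lam free))) })))

  -- Argument functions commute with renaming and substitution.

  module _ {Σ Σᵉˣ : Signature} (π : ArgFun Σ Σᵉˣ) where

    mutual
      -- At `fun f ss` both sides substitute into the same `π f`, whose variables are the positions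
      -- in `σs`. The composition law then leaves one equation per argument, hence the companion
      -- lemma on `lookup`.
      extend-ren : ∀ {V W : Scope} (ρ : ∀ {τ} → V τ → W τ) {τ} (s : Term Σ V τ) →
                   extend π (ren ρ s) ≡ ren ρ (extend π s)
      extend-ren ρ (var v)    = refl
      extend-ren ρ (s · t)    = cong₂ _·_ (extend-ren ρ s) (extend-ren ρ t)
      extend-ren ρ (lam s)    = cong lam (extend-ren (extᵣ ρ) s)
      extend-ren ρ (fun f ss) = sym (ren-sub (lookup-extends-rens ρ ss) (π f))

      lookup-extends-rens : ∀ {V W : Scope} (ρ : ∀ {τ} → V τ → W τ) {σs}
                            (ss : All (Term Σ V) σs) {σ} (i : σ ∈ σs) →
                            ren ρ (lookup (extends π ss) i) ≡
                            lookup (extends π (rens ρ ss)) i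
      lookup-extends-rens ρ (s ∷ ss) (here refl) = sym (extend-ren ρ s)
      lookup-extends-rens ρ (s ∷ ss) (there i)   = lookup-extends-rens ρ ss i

    mutual
      extend-sub : ∀ {V W : Scope} {γ : ∀ {τ} → V τ → Term Σ W τ}
                   {δ : ∀ {τ} → V τ → Term Σᵉˣ W τ} →
                   (∀ {τ} (v : V τ) → extend π (γ v) ≡ δ v) →
                   ∀ {τ} (s : Term Σ V τ) → extend π (sub γ s) ≡ sub δ (extend π s)
      extend-sub eq (var v)    = eq v
      extend-sub eq (s · t)    = cong₂ _·_ (extend-sub eq s) (extend-sub eq t)
      extend-sub {γ = γ} eq (lam s) = cong lam (extend-sub
        (λ { new     → refl
           ; (old v) → trans (extend-ren old (γ v)) (cong (ren old) (eq v)) }) s)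
      extend-sub eq (fun f ss) = sym (sub-sub (lookup-extends-subs eq ss) (π f))

      lookup-extends-subs : ∀ {V W : Scope} {γ : ∀ {τ} → V τ → Term Σ W τ}
                            {δ : ∀ {τ} → V τ → Term Σᵉˣ W τ} →
                            (∀ {τ} (v : V τ) → extend π (γ v) ≡ δ v) →
                            ∀ {σs} (ss : All (Term Σ V) σs) {σ} (i : σ ∈ σs) →
                            sub δ (lookup (extends π ss) i) ≡
                            lookup (extends π (subs γ ss)) i
      lookup-extends-subs eq (s ∷ ss) (here refl) = sym (extend-sub eq s)
      lookup-extends-subs eq (s ∷ ss) (there i)   = lookup-extends-subs eq ss i

    extend-[] : ∀ {V : Scope} {σ τ} (s : Term Σ (V ▸ σ) τ) (t : Term Σ V σ) →
                extend π (s [ t ]) ≡ extend π s [ extend π t ]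
    extend-[] s t = extend-sub (λ { new → refl ; (old v) → refl }) s

    lookup-extends : ∀ {V : Scope} {σs} (ss : All (Term Σ V) σs) {σ} (i : σ ∈ σs) →
                     lookup (extends π ss) i ≡ extend π (lookup ss i)
    lookup-extends (s ∷ ss) (here refl) = refl
    lookup-extends (s ∷ ss) (there i)   = lookup-extends ss i

    extendSpine : ∀ {σ τ} → Spine Σ σ τ → Spine Σᵉˣ σ τ
    extendSpine []       = []
    extendSpine (t ∷ ts) = extend π t ∷ extendSpine ts

    extend-·* : ∀ {σ τ} (s : Tm Σ σ) (ts : Spine Σ σ τ) →
                extend π (s ·* ts) ≡ extend π s ·* extendSpine ts
    extend-·* s []       = refl
    extend-·* s (t ∷ ts) = extend-·* (s · t) ts

    extendSubstitution : Substitution Σ → Substitution Σᵉˣ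
    extendSubstitution γ = record
      { apply  = λ x → extend π (apply x)
      ; domain = domain
      ; finite = λ x x∉ → cong (extend π) (finite x x∉)
      } where open Substitution γ

  -- Congruence properties of a reduction pair.

  module _ {Σ : Signature} {_≽_ _≻_ : Rel (SomeTm Σ) 0ℓ}
           (pair : IsReductionPair Σ _≽_ _≻_) where
    open IsReductionPair pair
    open IsPreorder ≽-isPreorder
      using () renaming (refl to ≽-refl; reflexive to ≽-reflexive; trans to ≽-trans)

    infix 4 _≽ₜ_

    _≽ₜ_ : ∀ {σ} → Rel (Tm Σ σ) 0ℓ
    _≽ₜ_ {σ} s t = (σ , s) ≽ (σ , t)

    ·-mono : ∀ {σ τ} {s s′ : Tm Σ (σ ⇒ τ)} {t t′ : Tm Σ σ} →
             s ≽ₜ s′ → t ≽ₜ t′ → s · t ≽ₜ s′ · t′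
    ·-mono {s′ = s′} {t} s≽ t≽ =
      ≽-trans (≽-monotonic (appˡ □ t) s≽) (≽-monotonic (appʳ s′ □) t≽)

    ·*-monoˡ : ∀ {σ τ} {s s′ : Tm Σ σ} (ts : Spine Σ σ τ) →
               s ≽ₜ s′ → s ·* ts ≽ₜ s′ ·* ts
    ·*-monoˡ []       s≽ = s≽
    ·*-monoˡ (t ∷ ts) s≽ = ·*-monoˡ ts (·-mono s≽ ≽-refl)

    data _≽*_ : ∀ {σs} → Rel (All (Tm Σ) σs) 0ℓ where
      []  : [] ≽* []
      _∷_ : ∀ {σ σs} {s t : Tm Σ σ} {ss ts : All (Tm Σ) σs} →
            s ≽ₜ t → ss ≽* ts → (s ∷ ss) ≽* (t ∷ ts)

    ≽*-refl : ∀ {σs} {ss : All (Tm Σ) σs} → ss ≽* ss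
    ≽*-refl {ss = []}    = []
    ≽*-refl {ss = _ ∷ _} = ≽-refl ∷ ≽*-refl

    lookup-≽* : ∀ {σs} {ss ts : All (Tm Σ) σs} → ss ≽* ts →
                ∀ {σ} (i : σ ∈ σs) → lookup ss i ≽ₜ lookup ts i
    lookup-≽* (s≽ ∷ _)  (here refl) = s≽
    lookup-≽* (_ ∷ ss≽) (there i)   = lookup-≽* ss≽ i

    -- `embed` puts the arguments already treated in front of an argument context.
    args-mono : ∀ {τ σs} (put : All (Tm Σ) σs → Tm Σ τ)
                (embed : ∀ {σ} → ArgContext Σ σ σs → Context Σ σ τ) →
                (∀ {σ} (Cs : ArgContext Σ σ σs) s →
                 fill (embed Cs) s ≡ put (fillArgs Cs s)) →
                ∀ {ss ts} → ss ≽* ts → put ss ≽ₜ put ts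
    args-mono put embed eq [] = ≽-refl
    args-mono put embed eq {s ∷ ss} {t ∷ ts} (s≽ ∷ ss≽) = ≽-trans
      (subst₂ _≽ₜ_ (eq (here □ ss) s) (eq (here □ ss) t)
        (≽-monotonic (embed (here □ ss)) s≽))
      (args-mono (put ∘ (t ∷_)) (embed ∘ there t) (λ Cs → eq (there t Cs)) ss≽)

    fun-mono : ∀ {σs τ} (f : Σ σs τ) {ss ts : All (Tm Σ) σs} → ss ≽* ts →
               fun f ss ≽ₜ fun f ts
    fun-mono f = args-mono (fun f) (fun f) (λ _ _ → refl)

    -- One name fresh for both abstractions opens them, and the context binding that name closes
    -- them again. The hypothesis ranges over all names because the fresh one is chosen only here.
    lam-mono : ∀ {σ τ} (s t : Term Σ (Name ▸ σ) τ) →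
               (∀ x → s [ var x ] ≽ₜ t [ var x ]) → lam s ≽ₜ lam t
    lam-mono s t s≽t with fresh (lam s) (lam t)
    ... | n , ∉s , ∉t = subst₂ _≽ₜ_ (ƛ-fresh x s ∉s) (ƛ-fresh x t ∉t)
                          (≽-monotonic (lam x □) (s≽t x))
      where x = name n

    mutual
      sub-mono : ∀ {V : Scope} {γ δ : ∀ {τ} → V τ → Tm Σ τ} →
                 (∀ {τ} (v : V τ) → γ v ≽ₜ δ v) →
                 ∀ {τ} (s : Term Σ V τ) → sub γ s ≽ₜ sub δ s
      sub-mono γ≽δ (var v)    = γ≽δ v
      sub-mono γ≽δ (s · t)    = ·-mono (sub-mono γ≽δ s) (sub-mono γ≽δ t)
      -- Both substitutions send the bound variable to the same name, so at `new` reflexivity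
      -- suffices.
      sub-mono {γ = γ} {δ} γ≽δ (lam s) = lam-mono _ _ λ x →
        subst₂ _≽ₜ_ (sym (sub-extₛ-[] γ s (var x))) (sym (sub-extₛ-[] δ s (var x)))
          (sub-mono {γ = γ ▹ var x} {δ ▹ var x}
            (λ { new → ≽-refl ; (old v) → γ≽δ v }) s)
      sub-mono γ≽δ (fun f ss) = fun-mono f (subs-mono γ≽δ ss)

      subs-mono : ∀ {V : Scope} {γ δ : ∀ {τ} → V τ → Tm Σ τ} →
                  (∀ {τ} (v : V τ) → γ v ≽ₜ δ v) →
                  ∀ {σs} (ss : All (Term Σ V) σs) → subs γ ss ≽* subs δ ss
      subs-mono γ≽δ []       = []
      subs-mono γ≽δ (s ∷ ss) = sub-mono γ≽δ s ∷ subs-mono γ≽δ ss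

    -- Descent from a term to its free variables.

    module _ (c : Constants Σ) where

      -- The base result type forces `ts` to be as long as `consts c σ`, and each argument can be
      -- lowered to the constant of its type.
      ·*-≽-saturate : (∀ σ (s : Tm Σ σ) → s ≽ₜ const c σ) →
                      ∀ {σ b} (s : Tm Σ σ) (ts : Spine Σ σ (base b)) →
                      (base b , s ·* ts) ≽ saturate c s
      ·*-≽-saturate ≽c s []       = ≽-refl
      ·*-≽-saturate ≽c s (t ∷ ts) = ≽-trans
        (·*-monoˡ ts (·-mono ≽-refl (≽c _ t)))
        (·*-≽-saturate ≽c (s · const c _) ts)

      -- Induction on the free occurrence, with `γ` and `ts` general: an application moves its
      -- argument onto the spine, and an abstraction takes one off it. At the variable, the spine
      -- gathered so far is lowered to constants.
      free-reachable :
        Respects _≽_ _≻_ (Subterm! c) → (∀ σ (s : Tm Σ σ) → s ≽ₜ const c σ) →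
        ∀ {V : Scope} (γ : ∀ {τ} → V τ → Tm Σ τ) {σ} {v : V σ} {τ b} {p : Term Σ V τ} →
        Free v p → (ts : Spine Σ τ (base b)) →
        Star (_≽_ ∪ _≻_) (base b , sub γ p ·* ts) (saturate c (γ v))
      free-reachable resp ≽c γ {v = v} var ts = inj₁ (·*-≽-saturate ≽c (γ v) ts) ◅ ε
      free-reachable resp ≽c γ (appˡ {t = t} free) ts =
        free-reachable resp ≽c γ free (sub γ t ∷ ts)
      -- The subterm relation saturates the argument it enters, so the descent restarts with a spine
      -- of constants.
      free-reachable resp ≽c γ (appʳ {s = s} {t} free) ts =
        resp (argument (sub γ s) (sub γ t) ts refl) ◅◅
        free-reachable resp ≽c γ free (consts c _)
      -- The spine of an abstraction ends in a base type, so it is not empty. The extended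
      -- substitution agrees with `γ` on `old` variables, which leaves the endpoint unchanged.
      free-reachable resp ≽c γ (lam {s = s} free) (t ∷ ts) =
        inj₁ (·*-monoˡ ts (≽-trans (≽-beta (sub (extₛ γ) s) t)
               (≽-reflexive (cong (_ ,_) (sub-extₛ-[] γ s t)))))
        ◅ free-reachable resp ≽c (γ ▹ t) free ts
      free-reachable resp ≽c γ (fun {f = f} {ss} i free) ts =
        resp (symbol f tt (subs γ ss) ts i refl) ◅◅
        subst (λ s → Star (_≽_ ∪ _≻_) (saturate c s) _) (sym (lookup-subs γ ss i))
          (free-reachable resp ≽c γ free (consts c _))

  -- The reduction pair pulled back along the argument function.

  module _ {Σ Σᵉˣ : Signature} (π : ArgFun Σ Σᵉˣ)
           {_≽_ _≻_ : Rel (SomeTm Σᵉˣ) 0ℓ}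
           (pair : IsReductionPair Σᵉˣ _≽_ _≻_) where
    open IsReductionPair pair
    open IsPreorder ≽-isPreorder
      using () renaming (refl to ≽-refl; reflexive to ≽-reflexive; trans to ≽-trans)
    open IsStrictPartialOrder ≻-isStrictPartialOrder
      using () renaming (irrefl to ≻-irrefl; trans to ≻-trans)

    private
      _≥_ _>_ : Rel (SomeTm Σ) 0ℓ
      _≥_ = _≽_ on extend′ π
      _>_ = _≻_ on extend′ π

    mutual
      fill-mono : ∀ {σ τ} (C : Context Σ σ τ) {s t : Tm Σ σ} →
                  (σ , s) ≥ (σ , t) → (τ , fill C s) ≥ (τ , fill C t)
      fill-mono □          s≥t = s≥t
      fill-mono (appˡ C u) s≥t = ·-mono pair (fill-mono C s≥t) ≽-refl
      fill-mono (appʳ u C) s≥t = ·-mono pair ≽-refl (fill-mono C s≥t)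
      -- Since `extend` commutes with the renaming by `bind x`, the image of the filled context is
      -- again an abstraction over the name `x`.
      fill-mono (lam x C) {s} {t} s≥t = subst₂ (_≽ₜ_ pair)
        (cong lam (sym (extend-ren π (bind x) (fill C s))))
        (cong lam (sym (extend-ren π (bind x) (fill C t))))
        (≽-monotonic (lam x □) (fill-mono C s≥t))
      -- `π f` may repeat or omit its variables or put them under binders, so the image need not be
      -- a context with one hole; the related arguments are substituted into `π f` instead.
      fill-mono (fun f Cs) s≥t =
        sub-mono pair (lookup-≽* pair (fillArgs-mono Cs s≥t)) (π f)

      fillArgs-mono : ∀ {σ σs} (Cs : ArgContext Σ σ σs) {s t : Tm Σ σ} →
                      (σ , s) ≥ (σ , t) →
                      _≽*_ pair (extends π (fillArgs Cs s)) (extends π (fillArgs Cs t))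
      fillArgs-mono (here C ts)  s≥t = fill-mono C s≥t ∷ ≽*-refl pair
      fillArgs-mono (there u Cs) s≥t = ≽-refl ∷ fillArgs-mono Cs s≥t

    extend-⟨⟩ : (γ : Substitution Σ) (s : SomeTm Σ) →
                extend′ π s ⟨ extendSubstitution π γ ⟩ ≡ extend′ π (s ⟨ γ ⟩)
    extend-⟨⟩ γ (σ , s) = cong (σ ,_) (sym (extend-sub π (λ _ → refl) s))

    compatible-on : Trans _≻_ _≽_ _≻_ ⊎ Trans _≽_ _≻_ _≻_ →
                    Trans _>_ _≥_ _>_ ⊎ Trans _≥_ _>_ _>_
    compatible-on (inj₁ ≻≽⊆≻) = inj₁ ≻≽⊆≻
    compatible-on (inj₂ ≽≻⊆≻) = inj₂ ≽≻⊆≻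

    isReductionPair-on : IsReductionPair Σ _≥_ _>_
    isReductionPair-on = record
      { ≽-isPreorder = record
        { isEquivalence = isEquivalence
        ; reflexive     = λ { refl → ≽-refl }
        ; trans         = ≽-trans
        }
      ; ≻-isStrictPartialOrder = record
        { isEquivalence = isEquivalence
        ; irrefl        = λ { refl → ≻-irrefl refl }
        ; trans         = ≻-trans
        ; <-resp-≈      = (λ { refl → id }) , (λ { refl → id })
        }
      ; ≻-wellFounded  = On.wellFounded (extend′ π) ≻-wellFounded
      ; compatible     = compatible-on compatible
      ; ≽-substitution = λ γ {s} {t} → subst₂ _≽_ (extend-⟨⟩ γ s) (extend-⟨⟩ γ t) ∘
                                       ≽-substitution (extendSubstitution π γ)
      ; ≻-substitution = λ γ {s} {t} → subst₂ _≻_ (extend-⟨⟩ γ s) (extend-⟨⟩ γ t) ∘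
                                       ≻-substitution (extendSubstitution π γ)
      ; ≽-monotonic    = fill-mono
      ; ≽-beta         = λ s t → ≽-trans (≽-beta (extend π s) (extend π t))
                           (≽-reflexive (cong (_ ,_) (sym (extend-[] π s t))))
      }

    -- Simulation of the subterm relation.

    module _ (c : Constants Σ) (cᵉˣ : Constants Σᵉˣ)
             (c≽ : ∀ σ → (σ , const cᵉˣ σ) ≽ (σ , extend π (const c σ))) where

      -- The constants on the spine are exchanged one at a time by `c≽`, since `π` may send those of
      -- `Σ` to other terms.
      consts-mono : ∀ σ (s : Tm Σᵉˣ σ) →
                    saturate cᵉˣ s ≽
                    (base (target σ) , s ·* extendSpine π (consts c σ))
      consts-mono (base _) s = ≽-refl
      consts-mono (σ ⇒ τ)  s = ≽-trans
        (·*-monoˡ pair (consts cᵉˣ τ) (·-mono pair ≽-refl (c≽ σ)))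
        (consts-mono τ (s · extend π (const c σ)))

      -- A descent over `Σᵉˣ` ends in a term saturated after translation, while the induction
      -- resumes from one saturated before it; this connects the two.
      saturate-extend : ∀ {σ} (s : Tm Σ σ) →
                        saturate cᵉˣ (extend π s) ≽ extend′ π (saturate c s)
      saturate-extend {σ} s = ≽-trans (consts-mono σ (extend π s))
        (≽-reflexive (cong (_ ,_) (sym (extend-·* π s (consts c σ)))))

      module _ (S : SymbolSet Σ) (subterm : SubtermProperty π S)
               (resp : Respects _≽_ _≻_ (Subterm! cᵉˣ))
               (≽c : ∀ σ (s : Tm Σᵉˣ σ) → (σ , s) ≽ (σ , const cᵉˣ σ)) where

        private
          _⟶*_ : Rel (SomeTm Σᵉˣ) 0ℓ
          _⟶*_ = Star (_≽_ ∪ _≻_)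

        mutual
          -- Each clause becomes a chain over `Σᵉˣ`: `beta` a β-step of the pulled-back pair,
          -- `symbol` a descent through `π f`, and `argument` a step of the same kind, since
          -- `extend` preserves applications.
          subterm-reachable : ∀ {s t} → Subterm c S s t → extend′ π s ⟶* extend′ π t
          subterm-reachable (beta s t ts u) =
            inj₁ (·*-monoˡ isReductionPair-on ts
                   (IsReductionPair.≽-beta isReductionPair-on s t))
            ◅ subterm⁼-reachable u
          -- The subterm property supplies a free occurrence of position `i` in `π f`, along which
          -- to descend to the translated argument.
          subterm-reachable (symbol f f∈S ss ts i u) =
            subst (λ s → (_ , s) ⟶* _) (sym (extend-·* π (fun f ss) ts))
              (free-reachable pair cᵉˣ resp ≽c (lookup (extends π ss))
                (subterm f f∈S i) (extendSpine π ts)) ◅◅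
            subst (λ s → saturate cᵉˣ s ⟶* _) (sym (lookup-extends π ss i))
              (inj₁ (saturate-extend (lookup ss i)) ◅ subterm⁼-reachable u)
          subterm-reachable (argument s t ts u) =
            subst (λ s → (_ , s) ⟶* _) (sym (extend-·* π (s · t) ts))
              (resp (argument (extend π s) (extend π t) (extendSpine π ts) refl)) ◅◅
            inj₁ (saturate-extend t) ◅ subterm⁼-reachable u

          subterm⁼-reachable : ∀ {s t} → ReflClosure (Subterm c S) s t →
                               extend′ π s ⟶* extend′ π t
          subterm⁼-reachable refl     = ε
          subterm⁼-reachable (step u) = subterm-reachable u

-- Intermediate terms of a chain over `Σᵉˣ` need not be images under `extend′ π`, so such a chain is
-- not by itself one of `_≥_` and `_>_` steps. Hence the chain between images is stated separately,
-- and `Respects` is derived from it under transitivity of the union.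
theorem7p8 :
    (Base : Set) (_≟_ : DecidableEquality Base) →
    let open AFS Base _≟_ hiding (_∪_) in
    (R : RewriteSystem)
    {Σ : Signature} {c : Constants Σ} {S : SymbolSet Σ} → Setting R Σ c S →
    (Σᵉˣ : Signature) (π : ArgFun Σ Σᵉˣ)
    (_≽_ _≻_ : Rel (SomeTm Σᵉˣ) 0ℓ) → IsReductionPair Σᵉˣ _≽_ _≻_ →
    let _≥_ = _≽_ on extend′ π
        _>_ = _≻_ on extend′ π
    in
    IsReductionPair Σ _≥_ _>_ ×
    ((cᵉˣ : Constants Σᵉˣ) →
     SubtermProperty π S →
     Respects _≽_ _≻_ (Subterm! cᵉˣ) →
     (∀ σ (s : Tm Σᵉˣ σ) → (σ , s) ≽ (σ , const cᵉˣ σ)) →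
     (∀ σ → (σ , const cᵉˣ σ) ≽ (σ , extend π (const c σ))) →
     (∀ {s t} → Subterm c S s t → Star (_≽_ ∪ _≻_) (extend′ π s) (extend′ π t)) ×
     (Transitive (_≽_ ∪ _≻_) → Respects _≥_ _>_ (Subterm c S)))
theorem7p8 Base _≟_ _ {c = c} {S} _ Σᵉˣ π _≽_ _≻_ pair =
  isReductionPair-on π pair ,
  λ cᵉˣ subterm resp ≽c c≽ →
    let reach = subterm-reachable π pair c cᵉˣ c≽ S subterm resp ≽c in
    (λ u → reach u) ,
    λ ∪-trans u →
      -- Reflexivity and transitivity collapse the chain to a single step between two images, which
      -- is a step of `_≥_` or `_>_` by definition.
      fold (_≽_ ∪ _≻_) ∪-trans
        (inj₁ (IsPreorder.refl (IsReductionPair.≽-isPreorder pair))) (reach u) ◅ ε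
    where open AFS Base _≟_ hiding (_∪_)
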